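{- Let $\eta_k := \prod_{j=1}^k(1-2^{ -j})$ for $k\in\mathbb{Z}_{\ge0}\cup\{\infty\}$ and \[ \gamma := \sum_{j=0}^\infty\frac{2^{ -j^2}\,\eta_\infty\,\eta_j^{ -2}}{2^{j+1}-1}. \] Then $\gamma=\frac12$.
   Context: All notation is defined in the claim; the empty product $\eta_0$ equals $1$. -}

module Defs where

open import Algebra.Definitions.RawSemiring using () renaming (_^_ to pow)
open import Data.Integer.Base as ℤ using (+_; +[1+_]; -[1+_])
open import Data.Nat.Base as ℕ using (ℕ; zero; suc)
import Data.Nat.Properties as ℕₚ
open import Data.Product.Base using (∃-syntax; _×_; _,_)
open import Data.Rational.Base
  using (ℚ; mkℚ; *≤*; *<*; 0ℚ; 1ℚ; ½; _+_; _*_; _-_; -_; 1/_; ∣_∣; _≤_; _<_;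
         NonZero; toℚᵘ; >-nonZero; positive; nonNegative; +-*-rawSemiring)
open import Data.Rational.Properties as ℚₚ using (module ≤-Reasoning)
import Data.Rational.Unnormalised.Base as ℚᵘ
import Data.Rational.Unnormalised.Properties as ℚᵘₚ
open import Data.Rational.Solver using (module +-*-Solver)
open import Data.Sum.Base using (inj₁; inj₂)
open import Relation.Binary.PropositionalEquality
  using (_≡_; refl; sym; trans; cong; cong₂; subst)

open +-*-Solver using (solve; _:=_; _:+_; _:*_; _:-_; :-_; con)

infixr 8 _^_

_^_ : ℚ → ℕ → ℚ
_^_ = pow +-*-rawSemiring

2ℚ : ℚ
2ℚ = 1ℚ + 1ℚ

0<½ : 0ℚ < ½
0<½ = *<* (ℤ.+<+ (ℕ.s≤s ℕ.z≤n))

0<1 : 0ℚ < 1ℚ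
0<1 = *<* (ℤ.+<+ (ℕ.s≤s ℕ.z≤n))

*-pos : ∀ {p q} → 0ℚ < p → 0ℚ < q → 0ℚ < p * q
*-pos {p} {q} 0<p 0<q = begin-strict
  0ℚ      ≡⟨ ℚₚ.*-zeroʳ p ⟨
  p * 0ℚ  <⟨ ℚₚ.*-monoʳ-<-pos p {{positive 0<p}} 0<q ⟩
  p * q   ∎
  where open ≤-Reasoning

*-mono-≤ : ∀ {p q r s} → 0ℚ ≤ r → 0ℚ ≤ q → p ≤ q → r ≤ s → p * r ≤ q * s
*-mono-≤ {p} {q} {r} {s} 0≤r 0≤q p≤q r≤s = begin
  p * r  ≤⟨ ℚₚ.*-monoʳ-≤-nonNeg r {{nonNegative 0≤r}} p≤q ⟩
  q * r  ≤⟨ ℚₚ.*-monoˡ-≤-nonNeg q {{nonNegative 0≤q}} r≤s ⟩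
  q * s  ∎
  where open ≤-Reasoning

½-pos : ∀ {ε} → 0ℚ < ε → 0ℚ < ½ * ε
½-pos = *-pos 0<½

halves : ∀ ε → ½ * ε + ½ * ε ≡ ε
halves ε = trans (sym (ℚₚ.*-distribʳ-+ ε ½ ½)) (ℚₚ.*-identityˡ ε)

∣p-q∣≡∣q-p∣ : ∀ p q → ∣ p - q ∣ ≡ ∣ q - p ∣
∣p-q∣≡∣q-p∣ p q = trans
  (cong ∣_∣ (solve 2 (λ p q → p :- q := :- (q :- p)) refl p q))
  (ℚₚ.∣-p∣≡∣p∣ (q - p))

∣p∣≤∣p-q∣+∣q∣ : ∀ p q → ∣ p ∣ ≤ ∣ p - q ∣ + ∣ q ∣
∣p∣≤∣p-q∣+∣q∣ p q = begin
  ∣ p ∣              ≡⟨ cong ∣_∣ (solve 2 (λ p q → p := (p :- q) :+ q) refl p q) ⟩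
  ∣ (p - q) + q ∣    ≤⟨ ℚₚ.∣p+q∣≤∣p∣+∣q∣ (p - q) q ⟩
  ∣ p - q ∣ + ∣ q ∣  ∎
  where open ≤-Reasoning

∣p∣-∣q∣≤∣p-q∣ : ∀ p q → ∣ p ∣ - ∣ q ∣ ≤ ∣ p - q ∣
∣p∣-∣q∣≤∣p-q∣ p q = begin
  ∣ p ∣ - ∣ q ∣                ≤⟨ ℚₚ.+-monoˡ-≤ (- ∣ q ∣) (∣p∣≤∣p-q∣+∣q∣ p q) ⟩
  ∣ p - q ∣ + ∣ q ∣ - ∣ q ∣    ≡⟨ solve 2 (λ a b → a :+ b :- b := a) refl ∣ p - q ∣ ∣ q ∣ ⟩
  ∣ p - q ∣                    ∎
  where open ≤-Reasoning

∣∣p∣-∣q∣∣≤∣p-q∣ : ∀ p q → ∣ ∣ p ∣ - ∣ q ∣ ∣ ≤ ∣ p - q ∣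
∣∣p∣-∣q∣∣≤∣p-q∣ p q with ℚₚ.∣p∣≡p∨∣p∣≡-p (∣ p ∣ - ∣ q ∣)
... | inj₁ eq = subst (_≤ ∣ p - q ∣) (sym eq) (∣p∣-∣q∣≤∣p-q∣ p q)
... | inj₂ eq = begin
  ∣ ∣ p ∣ - ∣ q ∣ ∣  ≡⟨ eq ⟩
  - (∣ p ∣ - ∣ q ∣)  ≡⟨ solve 2 (λ a b → :- (a :- b) := b :- a) refl ∣ p ∣ ∣ q ∣ ⟩
  ∣ q ∣ - ∣ p ∣      ≤⟨ ∣p∣-∣q∣≤∣p-q∣ q p ⟩
  ∣ q - p ∣          ≡⟨ ∣p-q∣≡∣q-p∣ q p ⟩
  ∣ p - q ∣          ∎
  where open ≤-Reasoning

interchange : ∀ a b c d → (a + b) - (c + d) ≡ (a - c) + (b - d)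
interchange = solve 4 (λ a b c d → (a :+ b) :- (c :+ d) := (a :- c) :+ (b :- d)) refl

neg-distrib-minus : ∀ a b → - a - - b ≡ - (a - b)
neg-distrib-minus = solve 2 (λ a b → :- a :- :- b := :- (a :- b)) refl

*-difference : ∀ a b c d → a * b - c * d ≡ a * (b - d) + d * (a - c)
*-difference = solve 4 (λ a b c d → a :* b :- c :* d := a :* (b :- d) :+ d :* (a :- c)) refl

telescope : ∀ a b c → a - c ≡ (a - b) + (b - c)
telescope = solve 3 (λ a b c → a :- c := (a :- b) :+ (b :- c)) refl

x-x[1-y] : ∀ x y → x - x * (1ℚ - y) ≡ x * y
x-x[1-y] = solve 2 (λ x y → x :- x :* (con 1ℚ :- y) := x :* y) refl

add-half : ∀ a b → (a - b) + ½ * b ≡ a - ½ * b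
add-half = solve 2 (λ a b → (a :- b) :+ con ½ :* b := a :- con ½ :* b) refl

∣+-difference∣ : ∀ a b c d → ∣ (a + b) - (c + d) ∣ ≤ ∣ a - c ∣ + ∣ b - d ∣
∣+-difference∣ a b c d = subst (λ z → ∣ z ∣ ≤ ∣ a - c ∣ + ∣ b - d ∣)
  (sym (interchange a b c d)) (ℚₚ.∣p+q∣≤∣p∣+∣q∣ (a - c) (b - d))

∣neg-difference∣ : ∀ a b → ∣ - a - - b ∣ ≡ ∣ a - b ∣
∣neg-difference∣ a b = trans (cong ∣_∣ (neg-distrib-minus a b)) (ℚₚ.∣-p∣≡∣p∣ (a - b))

∣*-difference∣ : ∀ a b c d → ∣ a * b - c * d ∣ ≤ ∣ a ∣ * ∣ b - d ∣ + ∣ d ∣ * ∣ a - c ∣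
∣*-difference∣ a b c d = begin
  ∣ a * b - c * d ∣                      ≡⟨ cong ∣_∣ (*-difference a b c d) ⟩
  ∣ a * (b - d) + d * (a - c) ∣          ≤⟨ ℚₚ.∣p+q∣≤∣p∣+∣q∣ (a * (b - d)) (d * (a - c)) ⟩
  ∣ a * (b - d) ∣ + ∣ d * (a - c) ∣      ≡⟨ cong₂ _+_ (ℚₚ.∣p*q∣≡∣p∣*∣q∣ a (b - d)) (ℚₚ.∣p*q∣≡∣p∣*∣q∣ d (a - c)) ⟩
  ∣ a ∣ * ∣ b - d ∣ + ∣ d ∣ * ∣ a - c ∣  ∎
  where open ≤-Reasoning

IsCauchy : (ℕ → ℚ) → Set
IsCauchy q = ∀ ε → 0ℚ < ε → ∃[ N ] (∀ m n → N ℕ.≤ m → N ℕ.≤ n → ∣ q m - q n ∣ ≤ ε)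

-- Equality of reals is the relation _≃_ below, not _≡_.
record ℝ : Set where
  constructor mkℝ
  field
    seq    : ℕ → ℚ
    cauchy : IsCauchy seq

open ℝ public

infix 4 _≃_ _≤ᴿ_

_≃_ : ℝ → ℝ → Set
x ≃ y = ∀ ε → 0ℚ < ε → ∃[ N ] (∀ n → N ℕ.≤ n → ∣ seq x n - seq y n ∣ ≤ ε)

_≤ᴿ_ : ℝ → ℝ → Set
x ≤ᴿ y = ∀ ε → 0ℚ < ε → ∃[ N ] (∀ n → N ℕ.≤ n → seq x n ≤ seq y n + ε)

⟦_⟧ : ℚ → ℝ
seq    ⟦ q ⟧ _     = q
cauchy ⟦ q ⟧ ε 0<ε =
  0 , λ _ _ _ _ → subst (λ z → ∣ z ∣ ≤ ε) (sym (ℚₚ.+-inverseʳ q)) (ℚₚ.<⇒≤ 0<ε)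

+-cauchy : ∀ {p q} → IsCauchy p → IsCauchy q → IsCauchy (λ n → p n + q n)
+-cauchy {p} {q} cp cq ε 0<ε =
  let M , hp = cp (½ * ε) (½-pos 0<ε)
      N , hq = cq (½ * ε) (½-pos 0<ε)
  in M ℕ.⊔ N , λ m n m≥ n≥ → begin
    ∣ (p m + q m) - (p n + q n) ∣
      ≤⟨ ∣+-difference∣ (p m) (q m) (p n) (q n) ⟩
    ∣ p m - p n ∣ + ∣ q m - q n ∣
      ≤⟨ ℚₚ.+-mono-≤
           (hp m n (ℕₚ.m⊔n≤o⇒m≤o M N m≥) (ℕₚ.m⊔n≤o⇒m≤o M N n≥))
           (hq m n (ℕₚ.m⊔n≤o⇒n≤o M N m≥) (ℕₚ.m⊔n≤o⇒n≤o M N n≥)) ⟩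
    ½ * ε + ½ * ε
      ≡⟨ halves ε ⟩
    ε ∎
  where open ≤-Reasoning

neg-cauchy : ∀ {p} → IsCauchy p → IsCauchy (λ n → - p n)
neg-cauchy {p} cp ε 0<ε =
  let N , h = cp ε 0<ε
  in N , λ m n m≥ n≥ →
    ℚₚ.≤-trans (ℚₚ.≤-reflexive (∣neg-difference∣ (p m) (p n))) (h m n m≥ n≥)

abs-cauchy : ∀ {p} → IsCauchy p → IsCauchy (λ n → ∣ p n ∣)
abs-cauchy {p} cp ε 0<ε =
  let N , h = cp ε 0<ε
  in N , λ m n m≥ n≥ → ℚₚ.≤-trans (∣∣p∣-∣q∣∣≤∣p-q∣ (p m) (p n)) (h m n m≥ n≥)

bounded : ∀ {p} → IsCauchy p → ∃[ B ] ∃[ N ] (0ℚ < B × (∀ n → N ℕ.≤ n → ∣ p n ∣ ≤ B))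
bounded {p} cp =
  let N , h = cp 1ℚ 0<1
  in 1ℚ + ∣ p N ∣ , N ,
     ℚₚ.+-mono-<-≤ 0<1 (ℚₚ.0≤∣p∣ (p N)) ,
     λ n n≥ → ℚₚ.≤-trans (∣p∣≤∣p-q∣+∣q∣ (p n) (p N))
                         (ℚₚ.+-monoˡ-≤ ∣ p N ∣ (h n N n≥ ℕₚ.≤-refl))

split : ∀ {B ε} → 0ℚ < B → 0ℚ < ε → ∃[ δ ] (0ℚ < δ × B * δ ≡ ½ * ε)
split {B} {ε} 0<B 0<ε = 1/B * (½ * ε) , *-pos 0<1/B (½-pos 0<ε) , (begin-equality
    B * (1/B * (½ * ε))  ≡⟨ ℚₚ.*-assoc B 1/B (½ * ε) ⟨
    B * 1/B * (½ * ε)    ≡⟨ cong (_* (½ * ε)) (ℚₚ.*-inverseʳ B {{B≢0}}) ⟩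
    1ℚ * (½ * ε)         ≡⟨ ℚₚ.*-identityˡ (½ * ε) ⟩
    ½ * ε                ∎)
  where
  open ≤-Reasoning
  B≢0 = >-nonZero 0<B
  1/B = (1/ B) {{B≢0}}
  0<1/B : 0ℚ < 1/B
  0<1/B = ℚₚ.positive⁻¹ 1/B {{ℚₚ.1/pos⇒pos B {{positive 0<B}}}}

*-cauchy : ∀ {p q} → IsCauchy p → IsCauchy q → IsCauchy (λ n → p n * q n)
*-cauchy {p} {q} cp cq ε 0<ε =
  let B , K , 0<B , hB = bounded {p} cp
      C , L , 0<C , hC = bounded {q} cq
      δ , 0<δ , Bδ≡ = split 0<B 0<ε
      κ , 0<κ , Cκ≡ = split 0<C 0<ε
      M , hp = cp κ 0<κ
      N , hq = cq δ 0<δ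
  in (K ℕ.⊔ L) ℕ.⊔ (M ℕ.⊔ N) , λ m n m≥ n≥ →
  let K⊔L≤m = ℕₚ.m⊔n≤o⇒m≤o (K ℕ.⊔ L) (M ℕ.⊔ N) m≥
      M⊔N≤m = ℕₚ.m⊔n≤o⇒n≤o (K ℕ.⊔ L) (M ℕ.⊔ N) m≥
      K⊔L≤n = ℕₚ.m⊔n≤o⇒m≤o (K ℕ.⊔ L) (M ℕ.⊔ N) n≥
      M⊔N≤n = ℕₚ.m⊔n≤o⇒n≤o (K ℕ.⊔ L) (M ℕ.⊔ N) n≥
  in begin
    ∣ p m * q m - p n * q n ∣
      ≤⟨ ∣*-difference∣ (p m) (q m) (p n) (q n) ⟩
    ∣ p m ∣ * ∣ q m - q n ∣ + ∣ q n ∣ * ∣ p m - p n ∣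
      ≤⟨ ℚₚ.+-mono-≤
           (*-mono-≤ (ℚₚ.0≤∣p∣ (q m - q n)) (ℚₚ.<⇒≤ 0<B)
             (hB m (ℕₚ.m⊔n≤o⇒m≤o K L K⊔L≤m))
             (hq m n (ℕₚ.m⊔n≤o⇒n≤o M N M⊔N≤m) (ℕₚ.m⊔n≤o⇒n≤o M N M⊔N≤n)))
           (*-mono-≤ (ℚₚ.0≤∣p∣ (p m - p n)) (ℚₚ.<⇒≤ 0<C)
             (hC n (ℕₚ.m⊔n≤o⇒n≤o K L K⊔L≤n))
             (hp m n (ℕₚ.m⊔n≤o⇒m≤o M N M⊔N≤m) (ℕₚ.m⊔n≤o⇒m≤o M N M⊔N≤n))) ⟩
    B * δ + C * κ
      ≡⟨ cong₂ _+_ Bδ≡ Cκ≡ ⟩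
    ½ * ε + ½ * ε
      ≡⟨ halves ε ⟩
    ε ∎
  where open ≤-Reasoning

infix  8 -ᴿ_
infixl 7 _*ᴿ_ _÷ᴿ_
infixl 6 _+ᴿ_ _-ᴿ_

_+ᴿ_ : ℝ → ℝ → ℝ
mkℝ p cp +ᴿ mkℝ q cq = mkℝ (λ n → p n + q n) (+-cauchy {p} {q} cp cq)

-ᴿ_ : ℝ → ℝ
-ᴿ mkℝ p cp = mkℝ (λ n → - p n) (neg-cauchy {p} cp)

_-ᴿ_ : ℝ → ℝ → ℝ
x -ᴿ y = x +ᴿ (-ᴿ y)

∣_∣ᴿ : ℝ → ℝ
∣ mkℝ p cp ∣ᴿ = mkℝ (λ n → ∣ p n ∣) (abs-cauchy {p} cp)

_*ᴿ_ : ℝ → ℝ → ℝ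
mkℝ p cp *ᴿ mkℝ q cq = mkℝ (λ n → p n * q n) (*-cauchy {p} {q} cp cq)

_÷ᴿ_ : ℝ → (q : ℚ) → .{{_ : NonZero q}} → ℝ
x ÷ᴿ q = x *ᴿ ⟦ 1/ q ⟧

infix 4 _⟶_

-- Convergence of a sequence of reals: rational ε suffices, since every positive
-- real is bounded below by a positive rational.
_⟶_ : (ℕ → ℝ) → ℝ → Set
s ⟶ x = ∀ ε → 0ℚ < ε → ∃[ N ] (∀ n → N ℕ.≤ n → ∣ s n -ᴿ x ∣ᴿ ≤ᴿ ⟦ ε ⟧)

seq-⟶ : ∀ x → (λ n → ⟦ seq x n ⟧) ⟶ x
seq-⟶ x ε 0<ε =
  let N , h = cauchy x ε 0<ε
  in N , λ n n≥ δ 0<δ → N , λ m m≥ → begin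
    ∣ seq x n - seq x m ∣  ≤⟨ h n m n≥ m≥ ⟩
    ε                      ≡⟨ ℚₚ.+-identityʳ ε ⟨
    ε + 0ℚ                 ≤⟨ ℚₚ.+-monoʳ-≤ ε (ℚₚ.<⇒≤ 0<δ) ⟩
    ε + δ                  ∎
  where open ≤-Reasoning

⟶-unique : ∀ {s x y} → s ⟶ x → s ⟶ y → x ≃ y
⟶-unique {s} {x} {y} s⟶x s⟶y ε 0<ε =
  let δ       = ½ * (½ * ε)
      0<δ     = ½-pos (½-pos 0<ε)
      K , hx  = s⟶x δ 0<δ
      L , hy  = s⟶y δ 0<δ
      n       = K ℕ.⊔ L
      M , hx′ = hx n (ℕₚ.m≤m⊔n K L) δ 0<δ
      N , hy′ = hy n (ℕₚ.m≤n⊔m K L) δ 0<δ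
  in M ℕ.⊔ N , λ m m≥ → let a = seq (s n) m; b = seq x m; c = seq y m in begin
    ∣ b - c ∣              ≡⟨ cong ∣_∣ (telescope b a c) ⟩
    ∣ (b - a) + (a - c) ∣  ≤⟨ ℚₚ.∣p+q∣≤∣p∣+∣q∣ (b - a) (a - c) ⟩
    ∣ b - a ∣ + ∣ a - c ∣  ≡⟨ cong (_+ ∣ a - c ∣) (∣p-q∣≡∣q-p∣ b a) ⟩
    ∣ a - b ∣ + ∣ a - c ∣  ≤⟨ ℚₚ.+-mono-≤ (hx′ m (ℕₚ.m⊔n≤o⇒m≤o M N m≥)) (hy′ m (ℕₚ.m⊔n≤o⇒n≤o M N m≥)) ⟩
    (δ + δ) + (δ + δ)      ≡⟨ cong₂ _+_ (halves (½ * ε)) (halves (½ * ε)) ⟩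
    ½ * ε + ½ * ε          ≡⟨ halves ε ⟩
    ε                      ∎
  where open ≤-Reasoning

partialSum : (ℕ → ℝ) → ℕ → ℝ
partialSum a zero    = ⟦ 0ℚ ⟧
partialSum a (suc n) = partialSum a n +ᴿ a n

HasSum : (ℕ → ℝ) → ℝ → Set
HasSum a s = partialSum a ⟶ s

η : ℕ → ℚ
η zero    = 1ℚ
η (suc k) = η k * (1ℚ - ½ ^ suc k)

0<½^ : ∀ k → 0ℚ < ½ ^ k
0<½^ zero    = 0<1
0<½^ (suc k) = ½-pos (0<½^ k)

½^≤1 : ∀ k → ½ ^ k ≤ 1ℚ
½^suc≤½ : ∀ k → ½ ^ suc k ≤ ½
½^≤1 zero    = ℚₚ.≤-refl
½^≤1 (suc k) = ℚₚ.≤-trans (½^suc≤½ k) (*≤* (ℤ.+≤+ (ℕ.s≤s ℕ.z≤n)))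
½^suc≤½ k = ℚₚ.≤-trans (ℚₚ.*-monoˡ-≤-nonNeg ½ (½^≤1 k)) (ℚₚ.≤-reflexive (ℚₚ.*-identityʳ ½))

0<factor : ∀ k → 0ℚ < 1ℚ - ½ ^ suc k
0<factor k = ℚₚ.<-≤-trans 0<½ (ℚₚ.+-monoʳ-≤ 1ℚ (ℚₚ.neg-antimono-≤ (½^suc≤½ k)))

factor≤1 : ∀ k → 1ℚ - ½ ^ suc k ≤ 1ℚ
factor≤1 k = ℚₚ.+-monoʳ-≤ 1ℚ (ℚₚ.neg-antimono-≤ (ℚₚ.<⇒≤ (0<½^ (suc k))))

η-positive : ∀ k → 0ℚ < η k
η-positive zero    = 0<1
η-positive (suc k) = *-pos (η-positive k) (0<factor k)

η-nonZero : ∀ k → NonZero (η k)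
η-nonZero k = >-nonZero (η-positive k)

η≤1 : ∀ k → η k ≤ 1ℚ
η≤1 zero    = ℚₚ.≤-refl
η≤1 (suc k) = *-mono-≤ (ℚₚ.<⇒≤ (0<factor k)) (ℚₚ.<⇒≤ 0<1) (η≤1 k) (factor≤1 k)

η-step : ∀ k → ∣ η k - η (suc k) ∣ ≤ ½ ^ suc k
η-step k = begin
  ∣ η k - η k * (1ℚ - ½ ^ suc k) ∣
    ≡⟨ cong ∣_∣ (x-x[1-y] (η k) (½ ^ suc k)) ⟩
  ∣ η k * ½ ^ suc k ∣
    ≡⟨ ℚₚ.0≤p⇒∣p∣≡p (ℚₚ.<⇒≤ (*-pos (η-positive k) (0<½^ (suc k)))) ⟩
  η k * ½ ^ suc k
    ≤⟨ ℚₚ.*-monoʳ-≤-nonNeg (½ ^ suc k) {{nonNegative (ℚₚ.<⇒≤ (0<½^ (suc k)))}} (η≤1 k) ⟩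
  1ℚ * ½ ^ suc k
    ≡⟨ ℚₚ.*-identityˡ (½ ^ suc k) ⟩
  ½ ^ suc k ∎
  where open ≤-Reasoning

η-tail : ∀ m d → ∣ η m - η (d ℕ.+ m) ∣ ≤ ½ ^ m - ½ ^ (d ℕ.+ m)
η-tail m zero = ℚₚ.≤-reflexive (trans
  (cong ∣_∣ (ℚₚ.+-inverseʳ (η m))) (sym (ℚₚ.+-inverseʳ (½ ^ m))))
η-tail m (suc d) = begin
  ∣ η m - η (suc k) ∣
    ≡⟨ cong ∣_∣ (telescope (η m) (η k) (η (suc k))) ⟩
  ∣ (η m - η k) + (η k - η (suc k)) ∣
    ≤⟨ ℚₚ.∣p+q∣≤∣p∣+∣q∣ (η m - η k) (η k - η (suc k)) ⟩
  ∣ η m - η k ∣ + ∣ η k - η (suc k) ∣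
    ≤⟨ ℚₚ.+-mono-≤ (η-tail m d) (η-step k) ⟩
  (½ ^ m - ½ ^ k) + ½ * ½ ^ k
    ≡⟨ add-half (½ ^ m) (½ ^ k) ⟩
  ½ ^ m - ½ ^ suc k ∎
  where
  open ≤-Reasoning
  k = d ℕ.+ m

η-close : ∀ {m n} → m ℕ.≤ n → ∣ η m - η n ∣ ≤ ½ ^ m
η-close {m} {n} m≤n = subst (λ k → ∣ η m - η k ∣ ≤ ½ ^ m) (ℕₚ.m∸n+n≡m m≤n) (begin
  ∣ η m - η k ∣    ≤⟨ η-tail m (n ℕ.∸ m) ⟩
  ½ ^ m - ½ ^ k    ≤⟨ ℚₚ.+-monoʳ-≤ (½ ^ m) (ℚₚ.neg-antimono-≤ (ℚₚ.<⇒≤ (0<½^ k))) ⟩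
  ½ ^ m + 0ℚ       ≡⟨ ℚₚ.+-identityʳ (½ ^ m) ⟩
  ½ ^ m            ∎)
  where
  open ≤-Reasoning
  k = (n ℕ.∸ m) ℕ.+ m

½^≤1/suc : ∀ k → toℚᵘ (½ ^ k) ℚᵘ.≤ ℚᵘ.mkℚᵘ (+ 1) k
½^≤1/suc zero    = ℚᵘₚ.≤-refl
½^≤1/suc (suc k) = begin
  toℚᵘ (½ * ½ ^ k)
    ≃⟨ ℚₚ.toℚᵘ-homo-* ½ (½ ^ k) ⟩
  ℚᵘ.½ ℚᵘ.* toℚᵘ (½ ^ k)
    ≤⟨ ℚᵘₚ.*-monoʳ-≤-nonNeg ℚᵘ.½ (½^≤1/suc k) ⟩
  ℚᵘ.½ ℚᵘ.* ℚᵘ.mkℚᵘ (+ 1) k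
    ≤⟨ ℚᵘ.*≤* (ℤ.+≤+ (ℕₚ.*-monoʳ-≤ 1 (ℕ.s≤s k+1≤k+suc[k+0]))) ⟩
  ℚᵘ.mkℚᵘ (+ 1) (suc k) ∎
  where
  open ℚᵘₚ.≤-Reasoning
  k+1≤k+suc[k+0] : suc k ℕ.≤ k ℕ.+ suc (k ℕ.+ 0)
  k+1≤k+suc[k+0] = ℕₚ.≤-trans (ℕ.s≤s (ℕₚ.m≤m+n k 0)) (ℕₚ.m≤n+m (suc (k ℕ.+ 0)) k)

½^-small : ∀ ε → 0ℚ < ε → ∃[ N ] (½ ^ N ≤ ε)
½^-small (mkℚ +[1+ n ] d _) _ = d , ℚₚ.toℚᵘ-cancel-≤
  (ℚᵘₚ.≤-trans (½^≤1/suc d)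
    (ℚᵘ.*≤* (ℤ.+≤+ (ℕₚ.*-monoˡ-≤ (suc d) {1} {suc n} (ℕ.s≤s ℕ.z≤n)))))
½^-small (mkℚ (+ zero) _ _) (*<* (ℤ.+<+ ()))
½^-small (mkℚ -[1+ _ ] _ _) (*<* ())

η-cauchy : IsCauchy η
η-cauchy ε 0<ε =
  let N , ½^N≤½ε = ½^-small (½ * ε) (½-pos 0<ε)
  in N , λ m n m≥ n≥ → begin
    ∣ η m - η n ∣
      ≡⟨ cong ∣_∣ (telescope (η m) (η N) (η n)) ⟩
    ∣ (η m - η N) + (η N - η n) ∣
      ≤⟨ ℚₚ.∣p+q∣≤∣p∣+∣q∣ (η m - η N) (η N - η n) ⟩
    ∣ η m - η N ∣ + ∣ η N - η n ∣
      ≡⟨ cong (_+ ∣ η N - η n ∣) (∣p-q∣≡∣q-p∣ (η m) (η N)) ⟩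
    ∣ η N - η m ∣ + ∣ η N - η n ∣
      ≤⟨ ℚₚ.+-mono-≤ (ℚₚ.≤-trans (η-close m≥) ½^N≤½ε) (ℚₚ.≤-trans (η-close n≥) ½^N≤½ε) ⟩
    ½ * ε + ½ * ε
      ≡⟨ halves ε ⟩
    ε ∎
  where open ≤-Reasoning

-- Its rational approximations are the partial products themselves.
η∞ : ℝ
η∞ = mkℝ η η-cauchy

η⟶η∞ : (λ k → ⟦ η k ⟧) ⟶ η∞
η⟶η∞ = seq-⟶ η∞

1≤2^ : ∀ k → 1ℚ ≤ 2ℚ ^ k
1≤2^ zero    = ℚₚ.≤-refl
1≤2^ (suc k) = *-mono-≤ {1ℚ} {2ℚ} (ℚₚ.<⇒≤ 0<1) (*≤* (ℤ.+≤+ ℕ.z≤n)) (*≤* (ℤ.+≤+ (ℕ.s≤s ℕ.z≤n))) (1≤2^ k)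

2^[1+j]-1-positive : ∀ j → 0ℚ < 2ℚ ^ suc j - 1ℚ
2^[1+j]-1-positive j = begin-strict
  0ℚ                <⟨ 0<1 ⟩
  2ℚ * 1ℚ - 1ℚ      ≤⟨ ℚₚ.+-monoˡ-≤ (- 1ℚ) (ℚₚ.*-monoˡ-≤-nonNeg 2ℚ (1≤2^ j)) ⟩
  2ℚ * 2ℚ ^ j - 1ℚ  ∎
  where open ≤-Reasoning

2^[1+j]-1-nonZero : ∀ j → NonZero (2ℚ ^ suc j - 1ℚ)
2^[1+j]-1-nonZero j = >-nonZero (2^[1+j]-1-positive j)

γ-term : ℕ → ℝ
γ-term j =
  _÷ᴿ_ (⟦ ½ ^ (j ℕ.* j) ⟧ *ᴿ η∞ *ᴿ ⟦ ((1/ η j) {{η-nonZero j}}) ^ 2 ⟧)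
       (2ℚ ^ suc j - 1ℚ) {{2^[1+j]-1-nonZero j}}

{-# OPTIONS --safe #-}

-- Put q = ½ and F a n = Σ_{j<n} q^(j²+aj) / (η_j η_{a+j}).  Since
-- 1/(2^{j+1}-1) = q^{j+1}/(1-q^{j+1}), the n-th partial sum of γ is ½ η_∞ F 1 n.
-- The difference F (a+1) n - F a n telescopes in j to q^(n²+an) (1-q^n) / (η_n η_{a+n}),
-- so F 1 n is close to F m n for every m; and for large m all terms of F m n
-- but the one at j = 0, which is 1/η_m, are negligible.  Hence F 1 n → 1/η_∞.
module Submission where

open import Defs
open import Algebra.Bundles using (CommutativeRing)
import Algebra.Properties.Semiring.Exp as Exp
import Data.Integer.Base as ℤ
open import Data.Nat.Base as ℕ using (ℕ; zero; suc)
import Data.Nat.Properties as ℕₚ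
import Data.Nat.Solver as ℕ-Solver
open import Data.Product.Base using (∃-syntax; _×_; _,_)
open import Data.Rational.Base
  using (ℚ; *≤*; 0ℚ; 1ℚ; ½; _+_; _*_; _-_; -_; 1/_; ∣_∣; _≤_; _<_; nonNegative; positive)
open import Data.Rational.Properties as ℚₚ using (module ≤-Reasoning)
open import Data.Rational.Solver using (module +-*-Solver)
open import Relation.Binary.PropositionalEquality
  using (_≡_; refl; sym; trans; cong; cong₂; subst; module ≡-Reasoning)

open +-*-Solver using (solve; _:=_; _:+_; _:*_; _:-_; con)

-- Powers of ½ and geometric estimates.

¼ 4ℚ 16ℚ : ℚ
¼   = ½ * ½
4ℚ  = 2ℚ * 2ℚ
16ℚ = 4ℚ * 4ℚ

½^-+ : ∀ m n → ½ ^ (m ℕ.+ n) ≡ ½ ^ m * ½ ^ n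
½^-+ = Exp.^-homo-* (CommutativeRing.semiring ℚₚ.+-*-commutativeRing) ½

½^-antitone : ∀ {m n} → m ℕ.≤ n → ½ ^ n ≤ ½ ^ m
½^-antitone {m} {n} m≤n = begin
  ½ ^ n                    ≡⟨ cong (½ ^_) (ℕₚ.m+[n∸m]≡n m≤n) ⟨
  ½ ^ (m ℕ.+ (n ℕ.∸ m))    ≡⟨ ½^-+ m (n ℕ.∸ m) ⟩
  ½ ^ m * ½ ^ (n ℕ.∸ m)    ≤⟨ ℚₚ.*-monoˡ-≤-nonNeg (½ ^ m) {{nonNegative (ℚₚ.<⇒≤ (0<½^ m))}} (½^≤1 (n ℕ.∸ m)) ⟩
  ½ ^ m * 1ℚ               ≡⟨ ℚₚ.*-identityʳ (½ ^ m) ⟩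
  ½ ^ m                    ∎
  where open ≤-Reasoning

½^*2^ : ∀ k → ½ ^ k * 2ℚ ^ k ≡ 1ℚ
½^*2^ zero    = refl
½^*2^ (suc k) = trans
  (solve 2 (λ a b → (con ½ :* a) :* (con 2ℚ :* b) := a :* b) refl (½ ^ k) (2ℚ ^ k))
  (½^*2^ k)

*-nonNeg : ∀ {p q} → 0ℚ ≤ p → 0ℚ ≤ q → 0ℚ ≤ p * q
*-nonNeg {p} {q} 0≤p 0≤q = subst (_≤ p * q) (ℚₚ.*-zeroʳ 0ℚ) (*-mono-≤ ℚₚ.≤-refl 0≤p 0≤p 0≤q)

-- The increments are bounded by differences `½ ^ k - ½ ^ suc k` so that the bounds telescope along
-- with `f`.
geometric-tail : ∀ (f : ℕ → ℚ) C → (∀ k → ∣ f k - f (suc k) ∣ ≤ C * (½ ^ k - ½ ^ suc k)) →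
                 ∀ d → ∣ f 0 - f d ∣ ≤ C * (1ℚ - ½ ^ d)
geometric-tail f C step zero = ℚₚ.≤-reflexive (trans
  (cong ∣_∣ (ℚₚ.+-inverseʳ (f 0))) (sym (ℚₚ.*-zeroʳ C)))
geometric-tail f C step (suc d) = begin
  ∣ f 0 - f (suc d) ∣
    ≡⟨ cong ∣_∣ (telescope (f 0) (f d) (f (suc d))) ⟩
  ∣ (f 0 - f d) + (f d - f (suc d)) ∣
    ≤⟨ ℚₚ.∣p+q∣≤∣p∣+∣q∣ (f 0 - f d) (f d - f (suc d)) ⟩
  ∣ f 0 - f d ∣ + ∣ f d - f (suc d) ∣
    ≤⟨ ℚₚ.+-mono-≤ (geometric-tail f C step d) (step d) ⟩
  C * (1ℚ - ½ ^ d) + C * (½ ^ d - ½ ^ suc d)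
    ≡⟨ solve 3 (λ c a b → c :* (con 1ℚ :- a) :+ c :* (a :- b) := c :* (con 1ℚ :- b))
         refl C (½ ^ d) (½ ^ suc d) ⟩
  C * (1ℚ - ½ ^ suc d) ∎
  where open ≤-Reasoning

geometric-bound : ∀ (f : ℕ → ℚ) C → 0ℚ ≤ C →
                  (∀ k → ∣ f k - f (suc k) ∣ ≤ C * (½ ^ k - ½ ^ suc k)) →
                  ∀ d → ∣ f 0 - f d ∣ ≤ C
geometric-bound f C 0≤C step d = begin
  ∣ f 0 - f d ∣       ≤⟨ geometric-tail f C step d ⟩
  C * (1ℚ - ½ ^ d)    ≤⟨ ℚₚ.*-monoˡ-≤-nonNeg C {{nonNegative 0≤C}}
                           (ℚₚ.+-monoʳ-≤ 1ℚ (ℚₚ.neg-antimono-≤ (ℚₚ.<⇒≤ (0<½^ d)))) ⟩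
  C * 1ℚ              ≡⟨ ℚₚ.*-identityʳ C ⟩
  C                   ∎
  where open ≤-Reasoning

-- Bounds for the partial products and their reciprocals.

-- The bound ¼ ≤ η alone is not inductive.
¼+½^≤η : ∀ k → ¼ + ½ ^ suc (suc k) ≤ η (suc k)
¼+½^≤η zero    = ℚₚ.≤-refl
¼+½^≤η (suc k) = begin
  ¼ + ½ * h
    ≡⟨ ℚₚ.+-identityʳ (¼ + ½ * h) ⟨
  (¼ + ½ * h) + 0ℚ
    -- Multiplying the induction hypothesis by `1ℚ - h` leaves the slack `h * (¼ - h)`, nonnegative
    -- because `h` is at most ¼.
    ≤⟨ ℚₚ.+-monoʳ-≤ (¼ + ½ * h) (*-nonNeg (ℚₚ.<⇒≤ (0<½^ (2 ℕ.+ k))) 0≤¼-h) ⟩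
  (¼ + ½ * h) + h * (¼ - h)
    ≡⟨ solve 1 (λ h → (con ¼ :+ con ½ :* h) :+ h :* (con ¼ :- h)
         := (con ¼ :+ h) :* (con 1ℚ :- h)) refl h ⟩
  (¼ + h) * (1ℚ - h)
    ≤⟨ ℚₚ.*-monoʳ-≤-nonNeg (1ℚ - h) {{nonNegative (ℚₚ.<⇒≤ (0<factor (suc k)))}} (¼+½^≤η k) ⟩
  η (suc k) * (1ℚ - h) ∎
  where
  open ≤-Reasoning
  h = ½ ^ suc (suc k)
  0≤¼-h : 0ℚ ≤ ¼ - h
  0≤¼-h = begin
    0ℚ     ≡⟨ ℚₚ.+-inverseʳ h ⟨
    h - h  ≤⟨ ℚₚ.+-monoˡ-≤ (- h) (½^-antitone {2} {2 ℕ.+ k} (ℕ.s≤s (ℕ.s≤s ℕ.z≤n))) ⟩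
    ¼ - h  ∎

¼≤η : ∀ k → ¼ ≤ η k
¼≤η zero    = *≤* (ℤ.+≤+ (ℕ.s≤s ℕ.z≤n))
¼≤η (suc k) = begin
  ¼                      ≡⟨ ℚₚ.+-identityʳ ¼ ⟨
  ¼ + 0ℚ                 ≤⟨ ℚₚ.+-monoʳ-≤ ¼ (ℚₚ.<⇒≤ (0<½^ (2 ℕ.+ k))) ⟩
  ¼ + ½ ^ suc (suc k)    ≤⟨ ¼+½^≤η k ⟩
  η (suc k)              ∎
  where open ≤-Reasoning

1/η : ℕ → ℚ
1/η k = (1/ η k) {{η-nonZero k}}

η*1/η : ∀ k → η k * 1/η k ≡ 1ℚ
η*1/η k = ℚₚ.*-inverseʳ (η k) {{η-nonZero k}}

1/η-positive : ∀ k → 0ℚ < 1/η k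
1/η-positive k = ℚₚ.positive⁻¹ (1/η k) {{ℚₚ.1/pos⇒pos (η k) {{positive (η-positive k)}}}}

1/η≤4 : ∀ k → 1/η k ≤ 4ℚ
1/η≤4 k = begin
  1/η k                ≡⟨ solve 1 (λ i → i := con 4ℚ :* (con ¼ :* i)) refl (1/η k) ⟩
  4ℚ * (¼ * 1/η k)     ≤⟨ ℚₚ.*-monoˡ-≤-nonNeg 4ℚ (ℚₚ.*-monoʳ-≤-nonNeg (1/η k)
                            {{nonNegative (ℚₚ.<⇒≤ (1/η-positive k))}} (¼≤η k)) ⟩
  4ℚ * (η k * 1/η k)   ≡⟨ cong (4ℚ *_) (η*1/η k) ⟩
  4ℚ                   ∎
  where open ≤-Reasoning

-- The recursion of `η`, inverted and kept free of division; it moves factors `1ℚ - ½ ^ suc k` in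
-- and out of the terms below.
1/η-suc : ∀ k → 1/η k ≡ 1/η (suc k) * (1ℚ - ½ ^ suc k)
1/η-suc k = begin
  i                    ≡⟨ ℚₚ.*-identityʳ i ⟨
  i * 1ℚ               ≡⟨ cong (i *_) (η*1/η (suc k)) ⟨
  i * ((e * f) * i′)   ≡⟨ solve 4 (λ i e f i′ → i :* ((e :* f) :* i′) := (e :* i) :* (i′ :* f)) refl i e f i′ ⟩
  (e * i) * (i′ * f)   ≡⟨ cong (_* (i′ * f)) (η*1/η k) ⟩
  1ℚ * (i′ * f)        ≡⟨ ℚₚ.*-identityˡ (i′ * f) ⟩
  i′ * f               ∎
  where
  open ≡-Reasoning
  i = 1/η k
  i′ = 1/η (suc k)
  e = η k
  f = 1ℚ - ½ ^ suc k

-- Durfee rectangle sums and their telescoping in `a`.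

t : ℕ → ℕ → ℚ
t a j = ½ ^ (j ℕ.* j ℕ.+ a ℕ.* j) * (1/η j * 1/η (a ℕ.+ j))

F : ℕ → ℕ → ℚ
F a zero    = 0ℚ
F a (suc n) = F a n + t a n

t-nonNeg : ∀ a j → 0ℚ ≤ t a j
t-nonNeg a j = ℚₚ.<⇒≤ (*-pos (0<½^ (j ℕ.* j ℕ.+ a ℕ.* j)) (*-pos (1/η-positive j) (1/η-positive (a ℕ.+ j))))

-- For k = j+1 ≥ 1 the exponent k² + ak is at least a + k, and each reciprocal is at most 4. The
-- term at index 0, which is 1/η_a, is not small.
t≤ : ∀ a j → t a (suc j) ≤ 16ℚ * ½ ^ (a ℕ.+ suc j)
t≤ a j = begin
  ½ ^ (k ℕ.* k ℕ.+ a ℕ.* k) * (1/η k * 1/η (a ℕ.+ k))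
    ≤⟨ *-mono-≤ (ℚₚ.<⇒≤ (*-pos (1/η-positive k) (1/η-positive (a ℕ.+ k)))) (ℚₚ.<⇒≤ (0<½^ (a ℕ.+ k)))
         (½^-antitone a+k≤)
         (*-mono-≤ (ℚₚ.<⇒≤ (1/η-positive (a ℕ.+ k))) (*≤* (ℤ.+≤+ ℕ.z≤n)) (1/η≤4 k) (1/η≤4 (a ℕ.+ k))) ⟩
  ½ ^ (a ℕ.+ k) * 16ℚ
    ≡⟨ ℚₚ.*-comm (½ ^ (a ℕ.+ k)) 16ℚ ⟩
  16ℚ * ½ ^ (a ℕ.+ k) ∎
  where
  open ≤-Reasoning
  k = suc j
  a+k≤ : a ℕ.+ k ℕ.≤ k ℕ.* k ℕ.+ a ℕ.* k
  a+k≤ = subst (ℕ._≤ k ℕ.* k ℕ.+ a ℕ.* k) (ℕₚ.+-comm k a)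
    (ℕₚ.+-mono-≤ (ℕₚ.m≤m*n k k) (ℕₚ.m≤m*n a k))

-- Here and in `t-suc-j` the shifted term is written over the common factor ½^(j²+aj) / (η_j
-- η_(a+j+1)), which reduces `t-difference` to a polynomial identity.
t-suc-a : ∀ a j → t (suc a) j ≡ ½ ^ (j ℕ.* j ℕ.+ a ℕ.* j) * ½ ^ j * (1/η j * 1/η (suc (a ℕ.+ j)))
t-suc-a a j = cong (_* (1/η j * 1/η (suc (a ℕ.+ j)))) (trans
  (cong (½ ^_) (trans (cong (j ℕ.* j ℕ.+_) (ℕₚ.+-comm j (a ℕ.* j))) (sym (ℕₚ.+-assoc (j ℕ.* j) (a ℕ.* j) j))))
  (½^-+ (j ℕ.* j ℕ.+ a ℕ.* j) j))

t-suc-j : ∀ a j → t a (suc j) * (1ℚ - ½ ^ suc j) ≡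
  ½ ^ (j ℕ.* j ℕ.+ a ℕ.* j) * (½ ^ j * ½ ^ suc (a ℕ.+ j)) * (1/η j * 1/η (suc (a ℕ.+ j)))
t-suc-j a j = begin
  ½ ^ (k ℕ.* k ℕ.+ a ℕ.* k) * (1/η k * 1/η (a ℕ.+ k)) * f
    ≡⟨ solve 4 (λ p i l f → p :* (i :* l) :* f := p :* ((i :* f) :* l)) refl
         (½ ^ (k ℕ.* k ℕ.+ a ℕ.* k)) (1/η k) (1/η (a ℕ.+ k)) f ⟩
  ½ ^ (k ℕ.* k ℕ.+ a ℕ.* k) * ((1/η k * f) * 1/η (a ℕ.+ k))
    ≡⟨ cong₂ (λ p l → ½ ^ p * l) exponent (cong₂ _*_ (sym (1/η-suc j)) (cong 1/η (ℕₚ.+-suc a j))) ⟩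
  ½ ^ (e ℕ.+ (j ℕ.+ suc (a ℕ.+ j))) * (1/η j * 1/η (suc (a ℕ.+ j)))
    ≡⟨ cong (_* (1/η j * 1/η (suc (a ℕ.+ j)))) (trans (½^-+ e (j ℕ.+ suc (a ℕ.+ j)))
         (cong (½ ^ e *_) (½^-+ j (suc (a ℕ.+ j))))) ⟩
  ½ ^ e * (½ ^ j * ½ ^ suc (a ℕ.+ j)) * (1/η j * 1/η (suc (a ℕ.+ j))) ∎
  where
  open ≡-Reasoning
  open ℕ-Solver.+-*-Solver using () renaming (solve to solveℕ; _:=_ to _:≡_; _:+_ to _⊕_; _:*_ to _⊗_; con to conℕ)
  k = suc j
  e = j ℕ.* j ℕ.+ a ℕ.* j
  f = 1ℚ - ½ ^ suc j
  exponent : k ℕ.* k ℕ.+ a ℕ.* k ≡ e ℕ.+ (j ℕ.+ suc (a ℕ.+ j))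
  exponent = solveℕ 2 (λ a j → (conℕ 1 ⊕ j) ⊗ (conℕ 1 ⊕ j) ⊕ a ⊗ (conℕ 1 ⊕ j)
    :≡ (j ⊗ j ⊕ a ⊗ j) ⊕ (j ⊕ (conℕ 1 ⊕ (a ⊕ j)))) refl a j

-- With x = ½^j and y = ½^(a+j+1), division by the common factor leaves x - (1-y) = xy - (1-y)(1-x).
-- The right side is the increment in j of `t a j * (1ℚ - ½ ^ j)`.
t-difference : ∀ a j →
  t (suc a) j - t a j ≡ t a (suc j) * (1ℚ - ½ ^ suc j) - t a j * (1ℚ - ½ ^ j)
t-difference a j = begin
  t (suc a) j - t a j
    ≡⟨ cong₂ _-_ (t-suc-a a j) t≡ ⟩
  p * x * (i * l) - p * (i * (l * (1ℚ - y)))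
    ≡⟨ solve 5 (λ p x i l y → p :* x :* (i :* l) :- p :* (i :* (l :* (con 1ℚ :- y)))
         := p :* (x :* y) :* (i :* l) :- p :* (i :* (l :* (con 1ℚ :- y))) :* (con 1ℚ :- x)) refl p x i l y ⟩
  p * (x * y) * (i * l) - p * (i * (l * (1ℚ - y))) * (1ℚ - x)
    ≡⟨ cong₂ (λ u v → u - v * (1ℚ - x)) (t-suc-j a j) t≡ ⟨
  t a (suc j) * (1ℚ - ½ ^ suc j) - t a j * (1ℚ - ½ ^ j) ∎
  where
  open ≡-Reasoning
  p = ½ ^ (j ℕ.* j ℕ.+ a ℕ.* j)
  x = ½ ^ j
  y = ½ ^ suc (a ℕ.+ j)
  i = 1/η j
  l = 1/η (suc (a ℕ.+ j))
  t≡ : t a j ≡ p * (i * (l * (1ℚ - y)))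
  t≡ = cong (λ z → p * (i * z)) (1/η-suc (a ℕ.+ j))

F-difference : ∀ a n → F (suc a) n - F a n ≡ t a n * (1ℚ - ½ ^ n)
-- The lower boundary term vanishes because 1 - ½^0 = 0.
F-difference a zero    = sym (ℚₚ.*-zeroʳ (t a 0))
F-difference a (suc n) = begin
  (F (suc a) n + t (suc a) n) - (F a n + t a n)
    ≡⟨ interchange (F (suc a) n) (t (suc a) n) (F a n) (t a n) ⟩
  (F (suc a) n - F a n) + (t (suc a) n - t a n)
    ≡⟨ cong₂ _+_ (F-difference a n) (t-difference a n) ⟩
  u + (v - u)
    ≡⟨ solve 2 (λ u v → u :+ (v :- u) := v) refl u v ⟩
  v ∎
  where
  open ≡-Reasoning
  u = t a n * (1ℚ - ½ ^ n)
  v = t a (suc n) * (1ℚ - ½ ^ suc n)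

-- Comparison of `F 1 (suc n)` with reciprocals of partial products.

-- Brings the bound of `t≤` into the form required by `geometric-bound`.
16½^-difference : ∀ n k → 16ℚ * ½ ^ (k ℕ.+ suc n) ≡ 16ℚ * ½ ^ n * (½ ^ k - ½ ^ suc k)
16½^-difference n k = trans (cong (16ℚ *_) (½^-+ k (suc n)))
  (solve 2 (λ x y → con 16ℚ :* (x :* (con ½ :* y)) := con 16ℚ :* y :* (x :- con ½ :* x)) refl (½ ^ k) (½ ^ n))

0≤16½^ : ∀ n → 0ℚ ≤ 16ℚ * ½ ^ n
0≤16½^ n = *-nonNeg {16ℚ} (*≤* (ℤ.+≤+ ℕ.z≤n)) (ℚₚ.<⇒≤ (0<½^ n))

F-step-a : ∀ n a → ∣ F a (suc n) - F (suc a) (suc n) ∣ ≤ 16ℚ * ½ ^ n * (½ ^ a - ½ ^ suc a)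
F-step-a n a = begin
  ∣ F a (suc n) - F (suc a) (suc n) ∣
    ≡⟨ ∣p-q∣≡∣q-p∣ (F a (suc n)) (F (suc a) (suc n)) ⟩
  ∣ F (suc a) (suc n) - F a (suc n) ∣
    ≡⟨ cong ∣_∣ (F-difference a (suc n)) ⟩
  ∣ t a (suc n) * (1ℚ - ½ ^ suc n) ∣
    ≡⟨ ℚₚ.0≤p⇒∣p∣≡p (*-nonNeg (t-nonNeg a (suc n)) (ℚₚ.<⇒≤ (0<factor n))) ⟩
  t a (suc n) * (1ℚ - ½ ^ suc n)
    ≤⟨ ℚₚ.*-monoˡ-≤-nonNeg (t a (suc n)) {{nonNegative (t-nonNeg a (suc n))}} (factor≤1 n) ⟩
  t a (suc n) * 1ℚ
    ≡⟨ ℚₚ.*-identityʳ (t a (suc n)) ⟩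
  t a (suc n)
    ≤⟨ t≤ a n ⟩
  16ℚ * ½ ^ (a ℕ.+ suc n)
    ≡⟨ 16½^-difference n a ⟩
  16ℚ * ½ ^ n * (½ ^ a - ½ ^ suc a) ∎
  where open ≤-Reasoning

F-step-n : ∀ m k → ∣ F m (suc k) - F m (suc (suc k)) ∣ ≤ 16ℚ * ½ ^ m * (½ ^ k - ½ ^ suc k)
F-step-n m k = begin
  ∣ F m (suc k) - (F m (suc k) + t m (suc k)) ∣
    ≡⟨ ∣p-q∣≡∣q-p∣ (F m (suc k)) (F m (suc (suc k))) ⟩
  ∣ (F m (suc k) + t m (suc k)) - F m (suc k) ∣
    ≡⟨ cong ∣_∣ (solve 2 (λ u v → (u :+ v) :- u := v) refl (F m (suc k)) (t m (suc k))) ⟩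
  ∣ t m (suc k) ∣
    ≡⟨ ℚₚ.0≤p⇒∣p∣≡p (t-nonNeg m (suc k)) ⟩
  t m (suc k)
    ≤⟨ t≤ m k ⟩
  16ℚ * ½ ^ (m ℕ.+ suc k)
    ≡⟨ cong (λ z → 16ℚ * ½ ^ z) (trans (ℕₚ.+-suc m k) (trans (cong suc (ℕₚ.+-comm m k)) (sym (ℕₚ.+-suc k m)))) ⟩
  16ℚ * ½ ^ (k ℕ.+ suc m)
    ≡⟨ 16½^-difference m k ⟩
  16ℚ * ½ ^ m * (½ ^ k - ½ ^ suc k) ∎
  where open ≤-Reasoning

F-one : ∀ m → F m 1 ≡ 1/η m
F-one m rewrite ℕₚ.*-zeroʳ m | ℕₚ.+-identityʳ m =
  solve 1 (λ x → con 0ℚ :+ con 1ℚ :* (con 1ℚ :* x) := x) refl (1/η m)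

-- First a runs from 1 to m = d+1, then the sum is cut down to its term at j = 0. The target is
-- 1/η_m at a finite index because the m-th approximation of `η∞` is η_m, which cancels it exactly.
F-close : ∀ n d → n ℕ.≤ d → ∣ F 1 (suc n) - 1/η (suc d) ∣ ≤ 16ℚ * ½ ^ n
F-close n d n≤d = begin
  ∣ F 1 (suc n) - 1/η m ∣
    ≡⟨ cong (λ z → ∣ F 1 (suc n) - z ∣) (F-one m) ⟨
  ∣ F 1 (suc n) - F m 1 ∣
    ≡⟨ cong ∣_∣ (telescope (F 1 (suc n)) (F m (suc n)) (F m 1)) ⟩
  ∣ (F 1 (suc n) - F m (suc n)) + (F m (suc n) - F m 1) ∣
    ≤⟨ ℚₚ.∣p+q∣≤∣p∣+∣q∣ (F 1 (suc n) - F m (suc n)) (F m (suc n) - F m 1) ⟩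
  ∣ F 1 (suc n) - F m (suc n) ∣ + ∣ F m (suc n) - F m 1 ∣
    ≤⟨ ℚₚ.+-mono-≤ vary-a vary-n ⟩
  16ℚ * ½ ^ suc n + 16ℚ * ½ ^ suc n
    ≡⟨ solve 1 (λ x → con 16ℚ :* (con ½ :* x) :+ con 16ℚ :* (con ½ :* x) := con 16ℚ :* x) refl (½ ^ n) ⟩
  16ℚ * ½ ^ n ∎
  where
  open ≤-Reasoning
  m = suc d
  vary-a : ∣ F 1 (suc n) - F m (suc n) ∣ ≤ 16ℚ * ½ ^ suc n
  vary-a = geometric-bound (λ k → F (suc k) (suc n)) (16ℚ * ½ ^ suc n) (0≤16½^ (suc n))
    -- Since a starts at 1, the steps gain a factor ½, which is moved into the constant.
    (λ k → ℚₚ.≤-trans (F-step-a n (suc k)) (ℚₚ.≤-reflexive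
      (solve 2 (λ x y → con 16ℚ :* y :* (con ½ :* x :- con ½ :* (con ½ :* x))
        := con 16ℚ :* (con ½ :* y) :* (x :- con ½ :* x)) refl (½ ^ k) (½ ^ n)))) d
  vary-n : ∣ F m (suc n) - F m 1 ∣ ≤ 16ℚ * ½ ^ suc n
  vary-n = begin
    ∣ F m (suc n) - F m 1 ∣
      ≡⟨ ∣p-q∣≡∣q-p∣ (F m (suc n)) (F m 1) ⟩
    ∣ F m 1 - F m (suc n) ∣
      ≤⟨ geometric-bound (λ k → F m (suc k)) (16ℚ * ½ ^ m) (0≤16½^ m) (F-step-n m) n ⟩
    16ℚ * ½ ^ m
      -- The hypothesis `n≤d` makes the discarded terms as small as the error from varying a.
      ≤⟨ ℚₚ.*-monoˡ-≤-nonNeg 16ℚ (½^-antitone (ℕ.s≤s n≤d)) ⟩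
    16ℚ * ½ ^ suc n ∎

-- Partial sums of the series and their limit.

-- As 1/(2^(j+1)-1) = ½^(j+1)/(1-½^(j+1)), the denominator raises the index of one reciprocal from j
-- to j+1; this is why a = 1 occurs.
1/η*1/[2^-1] : ∀ j → 1/η j * (1/ (2ℚ ^ suc j - 1ℚ)) {{2^[1+j]-1-nonZero j}} ≡ ½ ^ suc j * 1/η (suc j)
1/η*1/[2^-1] j = begin
  1/η j * r                  ≡⟨ cong (_* r) (1/η-suc j) ⟩
  i * (1ℚ - x) * r           ≡⟨ cong (λ z → i * (z - x) * r) (½^*2^ (suc j)) ⟨
  i * (x * y - x) * r        ≡⟨ solve 4 (λ i x y r → i :* (x :* y :- x) :* r
                                  := x :* i :* ((y :- con 1ℚ) :* r)) refl i x y r ⟩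
  x * i * ((y - 1ℚ) * r)     ≡⟨ cong (x * i *_) (ℚₚ.*-inverseʳ (y - 1ℚ) {{2^[1+j]-1-nonZero j}}) ⟩
  x * i * 1ℚ                 ≡⟨ ℚₚ.*-identityʳ (x * i) ⟩
  x * i                      ∎
  where
  open ≡-Reasoning
  i = 1/η (suc j)
  x = ½ ^ suc j
  y = 2ℚ ^ suc j
  r = (1/ (2ℚ ^ suc j - 1ℚ)) {{2^[1+j]-1-nonZero j}}

-- Of the factor ½^(j+1), the part ½^j turns the exponent j² into j² + j, and the remaining ½
-- becomes the value of the sum.
γ-term-seq : ∀ j m → seq (γ-term j) m ≡ ½ * η m * t 1 j
γ-term-seq j m = begin
  p * e * (i * (i * 1ℚ)) * r
    ≡⟨ solve 4 (λ p e i r → p :* e :* (i :* (i :* con 1ℚ)) :* r := p :* e :* i :* (i :* r)) refl p e i r ⟩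
  p * e * i * (i * r)
    ≡⟨ cong (p * e * i *_) (1/η*1/[2^-1] j) ⟩
  p * e * i * (½ * x * l)
    ≡⟨ solve 5 (λ p e i x l → p :* e :* i :* (con ½ :* x :* l) := con ½ :* e :* (p :* x :* (i :* l))) refl p e i x l ⟩
  ½ * e * (p * x * (i * l))
    ≡⟨ cong (λ z → ½ * e * (z * (i * l))) (trans
         (cong (λ k → ½ ^ (j ℕ.* j ℕ.+ k)) (ℕₚ.*-identityˡ j)) (½^-+ (j ℕ.* j) j)) ⟨
  ½ * e * t 1 j ∎
  where
  open ≡-Reasoning
  p = ½ ^ (j ℕ.* j)
  e = η m
  i = 1/η j
  r = (1/ (2ℚ ^ suc j - 1ℚ)) {{2^[1+j]-1-nonZero j}}
  x = ½ ^ j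
  l = 1/η (suc j)

partialSum-γ : ∀ n m → seq (partialSum γ-term n) m ≡ ½ * η m * F 1 n
partialSum-γ zero    m = sym (ℚₚ.*-zeroʳ (½ * η m))
partialSum-γ (suc n) m = trans
  (cong₂ _+_ (partialSum-γ n m) (γ-term-seq n m))
  (sym (ℚₚ.*-distribˡ-+ (½ * η m) (F 1 n) (t 1 n)))

partialSum-γ-close : ∀ n d → n ℕ.≤ d →
  ∣ seq (partialSum γ-term (suc n)) (suc d) - ½ ∣ ≤ 16ℚ * ½ ^ n
partialSum-γ-close n d n≤d = begin
  ∣ seq (partialSum γ-term (suc n)) m - ½ ∣
    -- The constant ½ computes from `½ * 1ℚ`, and `1ℚ` is then replaced by `η m * 1/η m` so that η_m
    -- factors out.
    ≡⟨ cong₂ (λ a b → ∣ a - ½ * b ∣) (partialSum-γ (suc n) m) (sym (η*1/η m)) ⟩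
  ∣ c * f - ½ * (η m * 1/η m) ∣
    ≡⟨ cong ∣_∣ (solve 3 (λ e f i → con ½ :* e :* f :- con ½ :* (e :* i) := con ½ :* e :* (f :- i)) refl (η m) f (1/η m)) ⟩
  ∣ c * (f - 1/η m) ∣
    ≡⟨ ℚₚ.∣p*q∣≡∣p∣*∣q∣ c (f - 1/η m) ⟩
  ∣ c ∣ * ∣ f - 1/η m ∣
    ≡⟨ cong (_* ∣ f - 1/η m ∣) (ℚₚ.0≤p⇒∣p∣≡p (ℚₚ.<⇒≤ (½-pos (η-positive m)))) ⟩
  c * ∣ f - 1/η m ∣
    ≤⟨ *-mono-≤ (ℚₚ.0≤∣p∣ (f - 1/η m)) (ℚₚ.<⇒≤ 0<1) c≤1 (F-close n d n≤d) ⟩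
  1ℚ * (16ℚ * ½ ^ n)
    ≡⟨ ℚₚ.*-identityˡ (16ℚ * ½ ^ n) ⟩
  16ℚ * ½ ^ n ∎
  where
  open ≤-Reasoning
  m = suc d
  c = ½ * η m
  f = F 1 (suc n)
  c≤1 : c ≤ 1ℚ
  c≤1 = *-mono-≤ {½} {1ℚ} (ℚₚ.<⇒≤ (η-positive m)) (ℚₚ.<⇒≤ 0<1) (½^≤1 1) (η≤1 m)

γ-sum : HasSum γ-term ⟦ ½ ⟧
γ-sum ε 0<ε =
  -- The factor `¼ * ¼` absorbs the constant 16.
  let N , ½^N≤ = ½^-small (¼ * ¼ * ε) (*-pos (*-pos (½-pos 0<½) (½-pos 0<½)) 0<ε)
  in suc N , λ where
    -- The approximation index starts at the number of summands, which supplies n ≤ d.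
    (suc n) (ℕ.s≤s N≤n) δ 0<δ → suc n , λ where
      (suc d) (ℕ.s≤s n≤d) → begin
        ∣ seq (partialSum γ-term (suc n)) (suc d) - ½ ∣
          ≤⟨ partialSum-γ-close n d n≤d ⟩
        16ℚ * ½ ^ n
          ≤⟨ ℚₚ.*-monoˡ-≤-nonNeg 16ℚ (ℚₚ.≤-trans (½^-antitone N≤n) ½^N≤) ⟩
        16ℚ * (¼ * ¼ * ε)
          ≡⟨ solve 1 (λ ε → con 16ℚ :* (con ¼ :* con ¼ :* ε) := ε :+ con 0ℚ) refl ε ⟩
        ε + 0ℚ
          ≤⟨ ℚₚ.+-monoʳ-≤ ε (ℚₚ.<⇒≤ 0<δ) ⟩
        ε + δ ∎
  where open ≤-Reasoning

theoremA1 : ∃[ γ ] (HasSum γ-term γ × γ ≃ ⟦ ½ ⟧)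
-- The constant real ½ is itself the sum, so the equality is reflexivity; by `⟶-unique` every other
-- sum of the series agrees with it.
theoremA1 = ⟦ ½ ⟧ , γ-sum , λ ε 0<ε → 0 , λ _ _ → ℚₚ.<⇒≤ 0<ε
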